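{- Let $G$ be a connected graph of order $n$ with minimum degree $\delta\geq 3$. Let $q_{\max}(G)$ denote the maximum, over all vertices $u\in V(G)$, of the number of connected components of $G\setminus u$ (the graph obtained from $G$ by deleting $u$). Then $rx_3(G)\leq n-q_{\max}(G)(\delta-1)+3$.
   Context: All graphs are finite, simple and undirected. Edge colorings are arbitrary (adjacent edges may receive the same color). In an edge-colored graph $G$, a tree $T\subseteq G$ (a subgraph that is a tree) is a rainbow tree if no two edges of $T$ have the same color. For a connected graph $G$ of order $n\ge 3$, a $3$-rainbow coloring of $G$ is an edge coloring such that for every set $S$ of $3$ vertices of $G$ there is a rainbow tree $T$ in $G$ with $S\subseteq V(T)$. The $3$-rainbow index $rx_3(G)$ is the minimum number of colors in a $3$-rainbow coloring of $G$. -}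

module Defs where

open import Data.Fin using (Fin; zero; suc; inject₁; fromℕ)
open import Data.Fin.Subset using (Subset; _∈_; _⊆_; ∁; ⁅_⁆; ∣_∣)
open import Data.Nat using (ℕ; _+_; _≤_)
open import Data.Product using (∃; ∃-syntax; _×_; _,_; proj₁)
open import Data.Sum using (_⊎_)
open import Data.Vec using (tabulate)
open import Function.Base using (_on_)
open import Function.Bundles using (Bijection)
open import Function.Definitions using (Injective)
open import Level using (Level; 0ℓ)
open import Relation.Binary using (Rel; Decidable; Symmetric; Setoid)
open import Relation.Binary.Construct.Closure.ReflexiveTransitive using (Star; ε; _◅◅_; reverse)
open import Relation.Binary.PropositionalEquality using (_≡_; setoid)
open import Relation.Nullary using (¬_; does)

private
  variable
    ℓ : Level
    V : Set
    n : ℕ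

IsMinimum : (ℕ → Set ℓ) → ℕ → Set ℓ
IsMinimum P m = P m × (∀ k → P k → m ≤ k)

IsMaximum : (ℕ → Set ℓ) → ℕ → Set ℓ
IsMaximum P m = P m × (∀ k → P k → k ≤ m)

-- Finiteness is imposed through the choice of V: it is always Fin n, or the
-- type of members of a Subset n.
record Graph (V : Set) : Set₁ where
  field
    Adj    : Rel V 0ℓ
    adj?   : Decidable Adj
    symm   : Symmetric Adj
    irrefl : ∀ {x} → ¬ Adj x x

open Graph public

Reachable : Graph V → Rel V 0ℓ
Reachable G = Star (Adj G)

Connected : Graph V → Set
Connected {V} G = V × (∀ x y → Reachable G x y)

-- The vertices of G up to reachability; its elements, as a setoid, are the
-- connected components of G.
components : Graph V → Setoid 0ℓ 0ℓ
components {V} G = record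
  { Carrier       = V
  ; _≈_           = Reachable G
  ; isEquivalence = record
      { refl  = ε
      ; sym   = reverse (symm G)
      ; trans = _◅◅_
      }
  }

HasComponents : Graph V → ℕ → Set
HasComponents G k = Bijection (components G) (setoid (Fin k))

-- A cycle v₀ v₁ … v₍ₖ₊₂₎ v₀ with k + 3 distinct vertices.
record Cycle (G : Graph V) : Set where
  field
    k        : ℕ
    v        : Fin (3 + k) → V
    distinct : Injective _≡_ _≡_ v
    step     : ∀ (i : Fin (2 + k)) → Adj G (v (inject₁ i)) (v (suc i))
    close    : Adj G (v (fromℕ (2 + k))) (v zero)

IsTree : Graph V → Set
IsTree G = Connected G × ¬ Cycle G

-- Proofs of membership in a Subset are unique, so Members S has exactly one
-- element for each element of S.
Members : Subset n → Set
Members S = ∃[ x ] x ∈ S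

induced : Graph (Fin n) → (S : Subset n) → Graph (Members S)
induced G S = record
  { Adj    = Adj G on proj₁
  ; adj?   = λ x y → adj? G (proj₁ x) (proj₁ y)
  ; symm   = symm G
  ; irrefl = irrefl G
  }

_∖_ : (G : Graph (Fin n)) (u : Fin n) → Graph (Members (∁ ⁅ u ⁆))
G ∖ u = induced G (∁ ⁅ u ⁆)

record Subgraph (G : Graph (Fin n)) : Set₁ where
  field
    vertices : Subset n
    graph    : Graph (Members vertices)
    edges⊆   : ∀ {x y} → Adj graph x y → Adj G (proj₁ x) (proj₁ y)

open Subgraph public

neighbours : Graph (Fin n) → Fin n → Subset n
neighbours G v = tabulate (λ w → does (adj? G v w))

degree : Graph (Fin n) → Fin n → ℕ
degree G v = ∣ neighbours G v ∣

IsMinDegree : Graph (Fin n) → ℕ → Set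
IsMinDegree G = IsMinimum (λ d → ∃[ v ] degree G v ≡ d)

IsQMax : Graph (Fin n) → ℕ → Set
IsQMax G = IsMaximum (λ k → ∃[ u ] HasComponents (G ∖ u) k)

-- A colouring of the edges with colours from Fin k: the colour of the edge xy
-- is colour x y. Values at non-adjacent pairs are junk and are never used.
record EdgeColouring (G : Graph (Fin n)) (k : ℕ) : Set where
  field
    colour      : Fin n → Fin n → Fin k
    colour-symm : ∀ x y → colour x y ≡ colour y x

open EdgeColouring public

-- Edges of T of the same colour coincide as unordered pairs.
IsRainbow : {G : Graph (Fin n)} {k : ℕ} → EdgeColouring G k → Subgraph G → Set
IsRainbow c T = ∀ {x y x′ y′} → Adj (graph T) x y → Adj (graph T) x′ y′ →
  colour c (proj₁ x) (proj₁ y) ≡ colour c (proj₁ x′) (proj₁ y′) →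
  (x ≡ x′ × y ≡ y′) ⊎ (x ≡ y′ × y ≡ x′)

Is3RainbowColouring : {G : Graph (Fin n)} {k : ℕ} → EdgeColouring G k → Set₁
Is3RainbowColouring {n} {G} c = ∀ (S : Subset n) → ∣ S ∣ ≡ 3 →
  ∃[ T ] IsTree (graph T) × IsRainbow {G = G} c T × S ⊆ vertices T

IsRx₃ : Graph (Fin n) → ℕ → Set₁
IsRx₃ G = IsMinimum (λ k → ∃[ c ] Is3RainbowColouring {G = G} {k} c)

{-# OPTIONS --safe #-}
-- Let u be a vertex for which G ∖ u has q components. Starting from u joined to
-- one neighbour in each component, grow a tree rooted at u one vertex at a time,
-- keeping in every component δ − 1 leaves: vertices outside the tree with a
-- neighbour in it. When nothing else is left, the tree has N edges with
-- N + 1 + q (δ − 1) = n, and N + 4 = n − q (δ − 1) + 3 colours suffice: N on the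
-- edges of the tree, one (link) between leaves, and three (low, mid, high) on the
-- edges from leaves to the tree. A leaf has at most δ − 2 neighbours among the
-- leaves, so it has two neighbours in the tree, and a third one unless it is
-- adjacent to all the leaves of its component. Hence it reaches the tree directly
-- with two of the three colours, one of them mid, and with the remaining colour
-- either directly or, after an edge of colour link, through another leaf. Of
-- three given vertices one is attached by low or high, one by mid, and the last
-- by the remaining colour; only this last attachment may use link.

module Submission where

open import Data.Bool using (if_then_else_; true; false; _∨_)
open import Data.Bool.Properties using (∨-comm)
open import Data.Empty using (⊥)
open import Data.Fin using (Fin; zero; suc; toℕ; inject₁; fromℕ; fromℕ<; splitAt; join; remQuot; combine; _≟_)
open import Data.Fin.Properties as Fin using (any?; suc-injective)
open import Data.Fin.Relation.Unary.Top using (view; ‵fromℕ; ‵inject₁)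
open import Data.Fin.Subset using (Subset; inside; outside; ∣_∣) renaming (_∈_ to _∈ˢ_)
open import Data.Fin.Subset.Properties using (x∉p⇒x∈∁p; x∈∁p⇒x∉p; x∈⁅x⁆; x∈⁅y⁆⇒x≡y)
open import Data.Integer using (+_; _+_; _-_; _*_; _≤_; -_; +≤+)
open import Data.Integer.Properties as ℤ using ()
open import Data.List using (List; []; _∷_; length; lookup; tabulate)
open import Data.List.Membership.DecPropositional using () renaming (_∈?_ to member?)
open import Data.List.Membership.Propositional using (_∈_; _∉_)
open import Data.List.Membership.Propositional.Properties using (∈-lookup)
  renaming (∈-tabulate⁺ to ∈-tabulate; ∈-tabulate⁻ to ∈-tabulate-inverse)
open import Data.List.Relation.Unary.All as All using (All; []; _∷_)
open import Data.List.Relation.Unary.All.Properties using (All¬⇒¬Any; ¬Any⇒All¬)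
open import Data.List.Relation.Unary.AllPairs using ([]; _∷_)
open import Data.List.Relation.Unary.Any using (here; there)
open import Data.List.Relation.Unary.Unique.Propositional using (Unique)
import Data.List.Relation.Unary.Unique.Propositional.Properties as Unique
open import Data.Nat as ℕ using (ℕ; zero; suc)
open import Data.Nat.Properties as ℕ using ()
open import Data.Product using (∃₂; ∃-syntax; _×_; _,_; proj₁; proj₂; uncurry)
open import Data.Sum using (_⊎_; inj₁; inj₂; [_,_]′; map; map₂)
open import Data.Vec as Vec using ([]; _∷_)
open import Data.Vec.Properties using (lookup∘tabulate; lookup⇒[]=; []=⇒lookup)
open import Data.Vec.Properties.WithK using ([]=-irrelevant)
import Data.Vec.Functional as F
open import Data.Vec.Functional.Properties using (updateAt-updates; updateAt-minimal)
open import Function.Base using (_∘_; _on_)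
open import Function.Bundles using (Bijection)
open import Function.Definitions using (Injective)
open import Relation.Binary.Construct.Closure.ReflexiveTransitive using (Star; ε; _◅_; _◅◅_; gmap; reverse)
open import Relation.Binary.PropositionalEquality
open import Relation.Nullary using (¬_; Dec; yes; no; does; contradiction)
open import Relation.Nullary.Decidable using (_×-dec_; _⊎-dec_; ¬?; dec-true; dec-false)
open import Defs

private
  variable
    n : ℕ

-- Finite subsets: enumeration and counting.

_∈?_ : (x : Fin n) (xs : List (Fin n)) → Dec (x ∈ xs)
_∈?_ = member? _≟_

Members-≡ : {S : Subset n} {x y : Members S} → proj₁ x ≡ proj₁ y → x ≡ y
Members-≡ {x = x , p} {.x , q} refl = cong (x ,_) ([]=-irrelevant p q)

module _ {P : Fin n → Set} (P? : ∀ x → Dec (P x)) where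

  ∈-tabulate⁺ : ∀ {x} → P x → x ∈ˢ Vec.tabulate (does ∘ P?)
  ∈-tabulate⁺ {x} px = lookup⇒[]= x _ (trans (lookup∘tabulate _ x) (dec-true (P? x) px))

  ∈-tabulate⁻ : ∀ {x} → x ∈ˢ Vec.tabulate (does ∘ P?) → P x
  ∈-tabulate⁻ {x} x∈ with P? x | trans (sym (lookup∘tabulate (does ∘ P?) x)) ([]=⇒lookup x∈)
  ... | yes px | _ = px
  ... | no _   | ()

enum : (S : Subset n) → Fin ∣ S ∣ → Fin n
enum (inside  ∷ S) zero    = zero
enum (inside  ∷ S) (suc i) = suc (enum S i)
enum (outside ∷ S) i       = suc (enum S i)

enum-∈ : (S : Subset n) (i : Fin ∣ S ∣) → enum S i ∈ˢ S
enum-∈ (inside  ∷ S) zero    = Vec.here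
enum-∈ (inside  ∷ S) (suc i) = Vec.there (enum-∈ S i)
enum-∈ (outside ∷ S) i       = Vec.there (enum-∈ S i)

enum-injective : (S : Subset n) → Injective _≡_ _≡_ (enum S)
enum-injective (inside  ∷ S) {zero}  {zero}  _  = refl
enum-injective (inside  ∷ S) {suc i} {suc j} eq = cong suc (enum-injective S (suc-injective eq))
enum-injective (outside ∷ S)                 eq = enum-injective S (suc-injective eq)

enum-surjective : (S : Subset n) {x : Fin n} → x ∈ˢ S → ∃[ i ] enum S i ≡ x
enum-surjective (inside  ∷ S) Vec.here       = zero , refl
enum-surjective (inside  ∷ S) (Vec.there x∈) with enum-surjective S x∈
... | i , eq = suc i , cong suc eq
enum-surjective (outside ∷ S) (Vec.there x∈) with enum-surjective S x∈
... | i , eq = i , cong suc eq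

enum-triple : (S : Subset n) → ∣ S ∣ ≡ 3 →
  ∃[ x ] ∃[ y ] ∃[ z ] (∀ {s} → s ∈ˢ S → s ∈ z ∷ y ∷ x ∷ [])
enum-triple S ∣S∣≡3 =
  let x , y , z , values = listed ∣S∣≡3 (enum S) in
  x , y , z , λ s∈ → let i , eq = enum-surjective S s∈ in subst (_∈ _) eq (values i)
  where
  -- The cardinality is a variable here so that its equation with 3 can be matched with `refl`.
  listed : ∀ {m k} → m ≡ 3 → (e : Fin m → Fin k) →
    ∃[ x ] ∃[ y ] ∃[ z ] (∀ i → e i ∈ z ∷ y ∷ x ∷ [])
  listed refl e = e (suc (suc zero)) , e (suc zero) , e zero , λ
    { zero → here refl ; (suc zero) → there (here refl) ; (suc (suc zero)) → there (there (here refl)) }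

-- Pigeonhole: if `f` hit every element of `S`, choosing preimages would inject `Fin ∣ S ∣` into
-- `Fin m`.
∃-outside : ∀ {m} (S : Subset n) (f : Fin m → Fin n) → m ℕ.< ∣ S ∣ →
            ∃[ x ] x ∈ˢ S × (∀ j → f j ≢ x)
∃-outside S f m<∣S∣ with any? (λ i → ¬? (any? (λ j → f j ≟ enum S i)))
... | yes (i , ∉f) = enum S i , enum-∈ S i , λ j eq → ∉f (j , eq)
... | no all∈f = contradiction (Fin.injective⇒≤ index-injective) (ℕ.<⇒≱ m<∣S∣)
  where
  hit : ∀ i → ∃[ j ] f j ≡ enum S i
  hit i with any? (λ j → f j ≟ enum S i)
  ... | yes p = p
  ... | no ¬p = contradiction (i , ¬p) all∈f

  index-injective : Injective _≡_ _≡_ (proj₁ ∘ hit)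
  index-injective {i} {i′} eq = enum-injective S
    (trans (sym (proj₂ (hit i))) (trans (cong f eq) (proj₂ (hit i′))))

-- Elements are chosen one at a time, each different from `u` and from the earlier ones; the one
-- spare element of `S` pays for the exclusion of `u`.
∃-injection-avoiding : ∀ p (S : Subset n) (u : Fin n) → suc p ℕ.≤ ∣ S ∣ →
  ∃[ f ] Injective {A = Fin p} _≡_ _≡_ f × (∀ j → f j ∈ˢ S) × (∀ j → f j ≢ u)
∃-injection-avoiding zero    S u _ = (λ ()) , (λ { {()} }) , (λ ()) , λ ()
∃-injection-avoiding (suc p) S u le
  with f , f-inj , f∈ , f≢u ← ∃-injection-avoiding p S u (ℕ.<⇒≤ le)
  with x , x∈ , x∉ ← ∃-outside S (u F.∷ f) le
  = x F.∷ f , inj , (λ { zero → x∈ ; (suc j) → f∈ j })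
            , (λ { zero → x∉ zero ∘ sym ; (suc j) → f≢u j })
  where
  inj : Injective _≡_ _≡_ (x F.∷ f)
  inj {zero}  {zero}  _  = refl
  inj {zero}  {suc j} eq = contradiction (sym eq) (x∉ (suc j))
  inj {suc i} {zero}  eq = contradiction eq (x∉ (suc i))
  inj {suc i} {suc j} eq = cong suc (f-inj eq)

-- These are the predecessor and the successor along the cycle. Played against `minDegree<2`, they
-- show that a grafted tree has no cycle.
cycle-neighbours : {V : Set} {G : Graph V} (C : Cycle G) → let open Cycle C in
  ∀ i → ∃₂ λ a b → a ≢ b × Adj G (v i) (v a) × Adj G (v i) (v b)
cycle-neighbours {G = G} C = go
  where
  open Cycle C
  go : ∀ i → ∃₂ λ a b → a ≢ b × Adj G (v i) (v a) × Adj G (v i) (v b)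
  go zero = suc zero , fromℕ (2 ℕ.+ k) , (λ ()) , step zero , symm G close
  go (suc j) with view j
  ... | ‵fromℕ = inject₁ j , zero , (λ ()) , symm G (step j) , close
  ... | ‵inject₁ j′ = inject₁ j , suc (suc j′) , neq , symm G (step j) , step (suc j′)
    where
    neq : inject₁ (inject₁ j′) ≢ suc (suc j′)
    -- As numbers, the two indices are `toℕ j′` and 2 more than that.
    neq eq = ℕ.m≢1+n+m (toℕ j′) {1}
      (trans (sym (trans (Fin.toℕ-inject₁ (inject₁ j′)) (Fin.toℕ-inject₁ j′))) (cong toℕ eq))

-- Rooted trees and their edge colours.

module RootedTree {n} (G : Graph (Fin n)) (u : Fin n) where

  -- The list consists of the vertices other than the root u, newest first.
  data Tree : List (Fin n) → Set where
    []    : Tree []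
    graft : ∀ {vs v w} → Tree vs → v ∉ u ∷ vs → w ∈ u ∷ vs → Adj G v w → Tree (v ∷ vs)

  ∈-weaken : ∀ {x v vs} → x ∈ u ∷ vs → x ∈ u ∷ v ∷ vs
  ∈-weaken (here eq)  = here eq
  ∈-weaken (there x∈) = there (there x∈)

  ∉-strengthen : ∀ {x v vs} → x ∉ u ∷ vs → x ≢ v → x ∉ u ∷ v ∷ vs
  ∉-strengthen x∉ x≢v (here eq)          = x∉ (here eq)
  ∉-strengthen x∉ x≢v (there (here eq))  = x≢v eq
  ∉-strengthen x∉ x≢v (there (there x∈)) = x∉ (there x∈)

  unique : ∀ {vs} → Tree vs → Unique (u ∷ vs)
  unique [] = [] ∷ []
  unique (graft t v∉ _ _) with unique t
  ... | u∉vs ∷ uniq = ((λ eq → v∉ (here (sym eq))) ∷ u∉vs) ∷ ¬Any⇒All¬ _ (v∉ ∘ there) ∷ uniq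

  Joins : Fin n → Fin n → Fin n → Fin n → Set
  Joins v w x y = (x ≡ v × y ≡ w) ⊎ (x ≡ w × y ≡ v)

  Edge : ∀ {vs} → Tree vs → Fin n → Fin n → Set
  Edge [] x y = ⊥
  Edge (graft {v = v} {w} t _ _ _) x y =
    Joins v w x y ⊎ Edge t x y

  edge? : ∀ {vs} (t : Tree vs) x y → Dec (Edge t x y)
  edge? [] x y = no λ ()
  edge? (graft {v = v} {w} t _ _ _) x y =
    ((x ≟ v ×-dec y ≟ w) ⊎-dec (x ≟ w ×-dec y ≟ v)) ⊎-dec edge? t x y

  Edge-sym : ∀ {vs} (t : Tree vs) {x y} → Edge t x y → Edge t y x
  Edge-sym (graft _ _ _ _) (inj₁ (inj₁ (p , q))) = inj₁ (inj₂ (q , p))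
  Edge-sym (graft _ _ _ _) (inj₁ (inj₂ (p , q))) = inj₁ (inj₁ (q , p))
  Edge-sym (graft t _ _ _) (inj₂ e)              = inj₂ (Edge-sym t e)

  Edge⇒Adj : ∀ {vs} (t : Tree vs) {x y} → Edge t x y → Adj G x y
  Edge⇒Adj (graft _ _ _ vw) (inj₁ (inj₁ (refl , refl))) = vw
  Edge⇒Adj (graft _ _ _ vw) (inj₁ (inj₂ (refl , refl))) = symm G vw
  Edge⇒Adj (graft t _ _ _)  (inj₂ e)                    = Edge⇒Adj t e

  Edge⇒∈ : ∀ {vs} (t : Tree vs) {x y} → Edge t x y → x ∈ u ∷ vs
  Edge⇒∈ (graft _ _ _ _)  (inj₁ (inj₁ (refl , _))) = there (here refl)
  Edge⇒∈ (graft _ _ w∈ _) (inj₁ (inj₂ (refl , _))) = ∈-weaken w∈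
  Edge⇒∈ (graft t _ _ _)  (inj₂ e)                 = ∈-weaken (Edge⇒∈ t e)

  path-to-root : ∀ {vs} (t : Tree vs) {x} → x ∈ u ∷ vs → Star (Edge t) x u
  path-to-root _                 (here refl)         = ε
  path-to-root (graft t _ w∈ _) (there (here refl)) =
    inj₁ (inj₁ (refl , refl)) ◅ gmap (λ x → x) inj₂ (path-to-root t w∈)
  path-to-root (graft t _ _ _)  (there (there x∈))  =
    gmap (λ x → x) inj₂ (path-to-root t (there x∈))

  -- The grafted vertex is new, so no older edge touches it.
  graft-edge : ∀ {vs v w y} (t : Tree vs) (v∉ : v ∉ u ∷ vs) (w∈ : w ∈ u ∷ vs) vw →
    Edge (graft t v∉ w∈ vw) v y → y ≡ w
  graft-edge t v∉ w∈ _ (inj₁ (inj₁ (_ , y≡w)))  = y≡w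
  graft-edge t v∉ w∈ _ (inj₁ (inj₂ (refl , _))) = contradiction w∈ v∉
  graft-edge t v∉ w∈ _ (inj₂ e)                 = contradiction (Edge⇒∈ t e) v∉

  -- The newest vertex has only one tree neighbour, so it is not in the family `z`. Removing it
  -- keeps all edges within the family, and the induction ends at a tree without edges.
  minDegree<2 : ∀ {vs m} (t : Tree vs) (z : Fin (suc m) → Fin n) →
    ¬ (∀ i → ∃₂ λ a b → z a ≢ z b × Edge t (z i) (z a) × Edge t (z i) (z b))
  minDegree<2 [] z deg₂ = proj₁ (proj₂ (proj₂ (proj₂ (deg₂ zero))))
  minDegree<2 (graft {v = v} t v∉ w∈ vw) z deg₂ with any? (λ i → z i ≟ v)
  ... | yes (i , refl) = let a , b , a≢b , ea , eb = deg₂ i in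
    a≢b (trans (graft-edge t v∉ w∈ vw ea) (sym (graft-edge t v∉ w∈ vw eb)))
  ... | no v∉z = minDegree<2 t z λ i → let a , b , a≢b , ea , eb = deg₂ i in
    a , b , a≢b , old ea , old eb
    where
    old : ∀ {i j} → Edge (graft t v∉ w∈ vw) (z i) (z j) → Edge t (z i) (z j)
    old {i}     (inj₁ (inj₁ (eq , _))) = contradiction (i , eq) v∉z
    old {j = j} (inj₁ (inj₂ (_ , eq))) = contradiction (j , eq) v∉z
    old         (inj₂ e)               = e

  module _ {vs} (t : Tree vs) where

    members : Subset n
    members = Vec.tabulate (does ∘ (_∈? (u ∷ vs)))

    members⁺ : ∀ {x} → x ∈ u ∷ vs → x ∈ˢ members
    members⁺ = ∈-tabulate⁺ (_∈? (u ∷ vs))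

    members⁻ : ∀ {x} → x ∈ˢ members → x ∈ u ∷ vs
    members⁻ = ∈-tabulate⁻ (_∈? (u ∷ vs))

    subgraph : Subgraph G
    subgraph = record
      { vertices = members
      ; graph    = record
        { Adj    = Edge t on proj₁
        ; adj?   = λ x y → edge? t (proj₁ x) (proj₁ y)
        ; symm   = Edge-sym t
        ; irrefl = irrefl G ∘ Edge⇒Adj t
        }
      ; edges⊆   = Edge⇒Adj t
      }

    restrict-path : ∀ {x y} → Star (Edge t) x y → (x∈ : x ∈ˢ members) (y∈ : y ∈ˢ members) →
      Reachable (graph subgraph) (x , x∈) (y , y∈)
    restrict-path ε x∈ y∈ = subst (Reachable (graph subgraph) _) (Members-≡ refl) ε
    restrict-path (e ◅ es) x∈ y∈ =
      _◅_ {j = _ , members⁺ (Edge⇒∈ t (Edge-sym t e))} e (restrict-path es _ y∈)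

    subgraph-isTree : IsTree (graph subgraph)
    subgraph-isTree = ((u , members⁺ (here refl)) , connected) , acyclic
      where
      connected : ∀ x y → Reachable (graph subgraph) x y
      connected (x , x∈) (y , y∈) = restrict-path
        (path-to-root t (members⁻ x∈) ◅◅ reverse (Edge-sym t) (path-to-root t (members⁻ y∈))) x∈ y∈

      acyclic : ¬ Cycle (graph subgraph)
      acyclic C = minDegree<2 t (proj₁ ∘ v) λ i →
        let a , b , a≢b , ea , eb = cycle-neighbours C i in
        a , b , (λ eq → a≢b (distinct (Members-≡ eq))) , ea , eb
        where open Cycle C

  module _ (c : Fin n → Fin n → ℕ) where

    -- There is one entry per graft, hence per edge, so that being rainbow becomes `Unique`.
    colours : ∀ {vs} → Tree vs → List ℕ
    colours [] = []
    colours (graft {v = v} {w} t _ _ _) = c v w ∷ colours t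

    module _ (c-sym : ∀ x y → c x y ≡ c y x) where

      colour-∈ : ∀ {vs} (t : Tree vs) {x y} → Edge t x y → c x y ∈ colours t
      colour-∈ (graft t _ _ _) (inj₁ (inj₁ (refl , refl))) = here refl
      colour-∈ (graft t _ _ _) (inj₁ (inj₂ (refl , refl))) = here (c-sym _ _)
      colour-∈ (graft t _ _ _) (inj₂ e)                    = there (colour-∈ t e)

      colour-joining : ∀ {v w x y} → Joins v w x y → c x y ≡ c v w
      colour-joining (inj₁ (refl , refl)) = refl
      colour-joining (inj₂ (refl , refl)) = c-sym _ _

      -- Edges from different grafts own different entries of a list without repetition, so equal
      -- colours force the same graft.
      rainbow : ∀ {vs} (t : Tree vs) → Unique (colours t) → ∀ {x y x′ y′} →
        Edge t x y → Edge t x′ y′ → c x y ≡ c x′ y′ → Joins x′ y′ x y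
      rainbow (graft t _ _ _) _ (inj₁ (inj₁ (refl , refl))) (inj₁ (inj₁ (refl , refl))) _ = inj₁ (refl , refl)
      rainbow (graft t _ _ _) _ (inj₁ (inj₁ (refl , refl))) (inj₁ (inj₂ (refl , refl))) _ = inj₂ (refl , refl)
      rainbow (graft t _ _ _) _ (inj₁ (inj₂ (refl , refl))) (inj₁ (inj₁ (refl , refl))) _ = inj₂ (refl , refl)
      rainbow (graft t _ _ _) _ (inj₁ (inj₂ (refl , refl))) (inj₁ (inj₂ (refl , refl))) _ = inj₁ (refl , refl)
      rainbow (graft t _ _ _) (new ∷ _) (inj₁ j) (inj₂ e) eq = contradiction
        (subst (_∈ colours t) (trans (sym eq) (colour-joining j)) (colour-∈ t e)) (All¬⇒¬Any new)
      rainbow (graft t _ _ _) (new ∷ _) (inj₂ e) (inj₁ j) eq = contradiction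
        (subst (_∈ colours t) (trans eq (colour-joining j)) (colour-∈ t e)) (All¬⇒¬Any new)
      rainbow (graft t _ _ _) (_ ∷ uniq) (inj₂ e) (inj₂ e′) eq = rainbow t uniq e e′ eq

-- Lists without repetition, and the components of `G ∖ u`.

∈∧∉⇒≢ : {A : Set} {x y : A} {xs : List A} → x ∈ xs → y ∉ xs → x ≢ y
∈∧∉⇒≢ x∈ y∉ refl = y∉ x∈

lookup-injective : {A : Set} {xs : List A} → Unique xs → Injective _≡_ _≡_ (lookup xs)
lookup-injective (_  ∷ _)    {zero}  {zero}  _  = refl
lookup-injective (x∉ ∷ _)    {zero}  {suc j} eq = contradiction eq (All.lookup x∉ (∈-lookup j))
lookup-injective (x∉ ∷ _)    {suc i} {zero}  eq = contradiction (sym eq) (All.lookup x∉ (∈-lookup i))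
lookup-injective (_  ∷ uniq) {suc i} {suc j} eq = cong suc (lookup-injective uniq eq)

-- Only these properties of the components of G ∖ u are needed: x ∈ᶜ i says
-- that x lies in the i-th one.
record Splitting {n} (G : Graph (Fin n)) (u : Fin n) (q : ℕ) : Set₁ where
  field
    _∈ᶜ_       : Fin n → Fin q → Set
    functional : ∀ {x i j} → x ∈ᶜ i → x ∈ᶜ j → i ≡ j
    closed     : ∀ {x y i} → x ∈ᶜ i → Adj G x y → y ≢ u → y ∈ᶜ i
    inhabited  : ∀ i → ∃[ x ] x ∈ᶜ i
    avoids     : ∀ {x i} → x ∈ᶜ i → x ≢ u

componentSplitting : ∀ {n q} (G : Graph (Fin n)) (u : Fin n) →
  HasComponents (G ∖ u) q → Splitting G u q
componentSplitting {n} {q} G u comps = record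
  { _∈ᶜ_       = λ x i → ∃[ x∈ ] to (x , x∈) ≡ i
  ; functional = λ { (_ , eq) (_ , eq′) → trans (sym eq) (trans (cong to (Members-≡ refl)) eq′) }
  -- An edge avoiding `u` is a path in `G ∖ u`, so both ends have the same component index.
  ; closed     = λ { (x∈ , eq) xy y≢u → let y∈ = x∉p⇒x∈∁p (y≢u ∘ x∈⁅y⁆⇒x≡y u) in
                     y∈ , trans (sym (to-cong (xy ◅ ε))) eq }
  ; inhabited  = λ i → let (x , x∈) , eq = strictlySurjective i in x , x∈ , eq
  ; avoids     = λ { (x∈ , _) refl → x∈∁p⇒x∉p x∈ (x∈⁅x⁆ u) }
  }
  where open Bijection comps using (to; strictlySurjective) renaming (cong to to-cong)

-- Growing the core tree and its leaves.

module Leafing {n q p} (G : Graph (Fin n)) (u : Fin n) (sp : Splitting G u q)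
  (connected : ∀ x → Reachable G x u) (deg : ∀ v → suc p ℕ.≤ degree G v) where

  open RootedTree G u
  open Splitting sp

  neighbour-outside : ∀ v (f : Fin p → Fin n) → ∃[ x ] Adj G v x × (∀ j → f j ≢ x)
  neighbour-outside v f with x , x∈ , x∉ ← ∃-outside (neighbours G v) f (deg v) =
    x , ∈-tabulate⁻ (adj? G v) x∈ , x∉

  Near : List (Fin n) → Fin n → Set
  Near vs x = ∃[ w ] w ∈ u ∷ vs × Adj G x w

  near? : ∀ vs x → Dec (Near vs x)
  near? vs x = any? λ w → (w ∈? (u ∷ vs)) ×-dec adj? G x w

  near-weaken : ∀ {vs v x} → Near vs x → Near (v ∷ vs) x
  near-weaken (w , w∈ , xw) = w , ∈-weaken w∈ , xw

  record Leaves (vs : List (Fin n)) : Set where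
    field
      leaf           : Fin q → Fin p → Fin n
      leaf-injective : ∀ i → Injective _≡_ _≡_ (leaf i)
      leaf-∈ᶜ        : ∀ i j → leaf i j ∈ᶜ i
      leaf-∉         : ∀ i j → leaf i j ∉ u ∷ vs
      leaf-near      : ∀ i j → Near vs (leaf i j)

    Covered : Fin n → Set
    Covered v = v ∈ u ∷ vs ⊎ ∃₂ λ i j → leaf i j ≡ v

    covered? : ∀ v → Dec (Covered v)
    covered? v = (v ∈? (u ∷ vs)) ⊎-dec any? λ i → any? λ j → leaf i j ≟ v

    -- A vertex lies in at most one component, so leaves of different components differ.
    leaf-injective₂ : ∀ {i j i′ j′} → leaf i j ≡ leaf i′ j′ → (i , j) ≡ (i′ , j′)
    leaf-injective₂ {i} {j} {i′} {j′} eq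
      with refl ← functional (leaf-∈ᶜ i j) (subst (_∈ᶜ i′) (sym eq) (leaf-∈ᶜ i′ j′))
      = cong (i ,_) (leaf-injective i eq)

  open Leaves

  -- Follow the path to the root up to its first vertex that is not far. That vertex is outside the
  -- tree, since otherwise its predecessor would be near.
  far-near-edge : ∀ {vs x} → Reachable G x u → x ∉ u ∷ vs → ¬ Near vs x →
    ∃₂ λ t v → t ∉ u ∷ vs × ¬ Near vs t × Adj G t v × v ∉ u ∷ vs × Near vs v
  far-near-edge ε x∉ _ = contradiction (here refl) x∉
  far-near-edge {vs} (_◅_ {j = y} xy path) x∉ far with y ∈? (u ∷ vs) | near? vs y
  ... | yes y∈ | _       = contradiction (y , y∈ , xy) far
  ... | no  y∉ | yes yn  = _ , y , x∉ , far , xy , y∉ , yn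
  ... | no  y∉ | no  far′ = far-near-edge path y∉ far′

  -- A leaf absorbed by the tree is replaced by a vertex that was far from the
  -- tree so far; hence no component ever loses leaves.
  grow : ∀ {vs} → Tree vs → (L : Leaves vs) → ∀ x → ¬ Covered L x →
         ∃[ v ] Tree (v ∷ vs) × Leaves (v ∷ vs)
  grow {vs} T L x x-uncovered with near? vs x
  -- A near vertex that is not a leaf can be grafted without touching the leaves.
  ... | yes (w , w∈ , xw) = x , graft T (x-uncovered ∘ inj₁) w∈ xw , record
    { leaf           = leaf L
    ; leaf-injective = leaf-injective L
    ; leaf-∈ᶜ        = leaf-∈ᶜ L
    ; leaf-∉         = λ i j → ∉-strengthen (leaf-∉ L i j) λ eq → x-uncovered (inj₂ (i , j , eq))
    ; leaf-near      = λ i j → near-weaken (leaf-near L i j)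
    }
  ... | no far
    with t , v , t∉ , t-far , tv , v∉ , w , w∈ , vw ← far-near-edge (connected x) (x-uncovered ∘ inj₁) far
    = v , graft T v∉ w∈ vw , record
    { leaf           = leaf′
    ; leaf-injective = λ i {j} {j′} → injective′ i j j′
    ; leaf-∈ᶜ        = ∈ᶜ′
    ; leaf-∉         = ∉′
    ; leaf-near      = near′
    }
    where
    leaf′ : Fin q → Fin p → Fin n
    leaf′ i j with leaf L i j ≟ v
    ... | yes _ = t
    ... | no  _ = leaf L i j

    -- All leaves are near and `t` is far, so putting `t` in the place of `v` keeps the leaves
    -- distinct.
    t-not-leaf : ∀ i j → leaf L i j ≢ t
    t-not-leaf i j eq = t-far (subst (Near vs) eq (leaf-near L i j))

    injective′ : ∀ i j j′ → leaf′ i j ≡ leaf′ i j′ → j ≡ j′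
    injective′ i j j′ eq with leaf L i j ≟ v | leaf L i j′ ≟ v
    ... | yes j≡v | yes j′≡v = leaf-injective L i (trans j≡v (sym j′≡v))
    ... | yes _   | no _     = contradiction (sym eq) (t-not-leaf i j′)
    ... | no _    | yes _    = contradiction eq (t-not-leaf i j)
    ... | no _    | no _     = leaf-injective L i eq

    ∈ᶜ′ : ∀ i j → leaf′ i j ∈ᶜ i
    ∈ᶜ′ i j with leaf L i j ≟ v
    ... | yes eq = closed (subst (_∈ᶜ i) eq (leaf-∈ᶜ L i j)) (symm G tv) (t∉ ∘ here)
    ... | no  _  = leaf-∈ᶜ L i j

    ∉′ : ∀ i j → leaf′ i j ∉ u ∷ v ∷ vs
    ∉′ i j with leaf L i j ≟ v
    ... | yes _  = ∉-strengthen t∉ λ { refl → irrefl G tv }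
    ... | no neq = ∉-strengthen (leaf-∉ L i j) neq

    near′ : ∀ i j → Near (v ∷ vs) (leaf′ i j)
    near′ i j with leaf L i j ≟ v
    ... | yes _ = v , there (here refl) , tv
    ... | no  _ = near-weaken (leaf-near L i j)

  record Saturated : Set where
    field
      {core}  : List (Fin n)
      tree    : Tree core
      leaves  : Leaves core
      covered : ∀ x → Covered leaves x

  tree-size : ∀ {vs} → Tree vs → suc (length vs) ℕ.≤ n
  tree-size T = Fin.injective⇒≤ (lookup-injective (unique T))

  -- Each growth step trades one unit of fuel for one vertex of the list. Fuel zero would give
  -- `n ≤ length vs`, which `tree-size` excludes.
  saturate : ∀ fuel {vs} → n ℕ.≤ fuel ℕ.+ length vs → Tree vs → Leaves vs → Saturated
  saturate zero       n≤ T L = contradiction n≤ (ℕ.<⇒≱ (tree-size T))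
  saturate (suc fuel) n≤ T L with Fin.all? (covered? L)
  ... | yes cov = record { tree = T ; leaves = L ; covered = cov }
  ... | no ¬cov
    with x , x-uncovered ← Fin.¬∀⟶∃¬ n (Covered L) (covered? L) ¬cov
    with v , T′ , L′ ← grow T L x x-uncovered
    = saturate fuel (subst (n ℕ.≤_) (sym (ℕ.+-suc fuel _)) n≤) T′ L′

  star : ∀ {m} (w : Fin m → Fin n) → Injective _≡_ _≡_ w → (∀ i → Adj G (w i) u) →
         Tree (tabulate w)
  star {zero}  w _   _  = []
  star {suc m} w inj wu = graft
    (star (w ∘ suc) (λ eq → suc-injective (inj eq)) (wu ∘ suc))
    (λ { (here eq)   → irrefl G (subst (λ x → Adj G x u) eq (wu zero))
       ; (there w₀∈) → let i , eq = ∈-tabulate-inverse w₀∈ in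
                       contradiction (inj eq) λ () })
    (here refl) (wu zero)

  -- A path to the root stays in its component until it first meets `u`; the vertex just before is
  -- the neighbour sought.
  root-neighbour : ∀ {x i} → Reachable G x u → x ∈ᶜ i → ∃[ w ] w ∈ᶜ i × Adj G w u
  root-neighbour ε x∈ = contradiction refl (avoids x∈)
  root-neighbour {x} (_◅_ {j = y} xy path) x∈ with y ≟ u
  ... | yes refl = x , x∈ , xy
  ... | no  y≢u  = root-neighbour path (closed x∈ xy y≢u)

  -- The initial tree is the star joining `u` to one hub in each component. A hub has at least
  -- `suc p` neighbours, so `p` of them other than `u` can serve as leaves.
  saturated : Saturated
  saturated = saturate n (ℕ.m≤m+n n _) (star hub hub-injective (proj₂ ∘ proj₂ ∘ hubs)) record
    { leaf           = λ i → proj₁ (around i)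
    ; leaf-injective = λ i → proj₁ (proj₂ (around i))
    ; leaf-∈ᶜ        = in-component
    ; leaf-∉         = not-in-star
    ; leaf-near      = λ i j → hub i , there (∈-tabulate i) , symm G (adjacent i j)
    }
    where
    hubs : ∀ i → ∃[ w ] w ∈ᶜ i × Adj G w u
    hubs i = let x , x∈ = inhabited i in root-neighbour (connected x) x∈

    hub : Fin q → Fin n
    hub = proj₁ ∘ hubs

    hub-∈ᶜ : ∀ i → hub i ∈ᶜ i
    hub-∈ᶜ = proj₁ ∘ proj₂ ∘ hubs

    hub-injective : Injective _≡_ _≡_ hub
    hub-injective {i} {j} eq = functional (hub-∈ᶜ i) (subst (_∈ᶜ j) (sym eq) (hub-∈ᶜ j))

    around : ∀ i → ∃[ f ] Injective {A = Fin p} _≡_ _≡_ f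
                        × (∀ j → f j ∈ˢ neighbours G (hub i)) × (∀ j → f j ≢ u)
    around i = ∃-injection-avoiding p (neighbours G (hub i)) u (deg (hub i))

    adjacent : ∀ i j → Adj G (hub i) (proj₁ (around i) j)
    adjacent i j = ∈-tabulate⁻ (adj? G (hub i)) (proj₁ (proj₂ (proj₂ (around i))) j)

    in-component : ∀ i j → proj₁ (around i) j ∈ᶜ i
    in-component i j = closed (hub-∈ᶜ i) (adjacent i j) (proj₂ (proj₂ (proj₂ (around i))) j)

    not-in-star : ∀ i j → proj₁ (around i) j ∉ u ∷ tabulate hub
    not-in-star i j (here eq)  = avoids (in-component i j) eq
    not-in-star i j (there x∈)
      with k , eq ← ∈-tabulate-inverse x∈
      -- Distinct hubs lie in distinct components, so a leaf could only coincide with its own hub,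
      -- which would be a loop.
      with refl ← functional (in-component i j) (subst (_∈ᶜ k) (sym eq) (hub-∈ᶜ k))
      = irrefl G (subst (Adj G (hub i)) eq (adjacent i j))

-- The colouring with N + 4 colours.

module Colouring {n q p} (G : Graph (Fin n)) (u : Fin n) (sp : Splitting G u q)
  (connected : ∀ x → Reachable G x u) (deg : ∀ v → 3 ℕ.+ p ℕ.≤ degree G v)
  (saturated : Leafing.Saturated {p = 2 ℕ.+ p} G u sp connected deg) where

  open RootedTree G u
  open Splitting sp
  open Leafing {p = 2 ℕ.+ p} G u sp connected deg hiding (saturated)
  open Saturated saturated
  open Leaves leaves

  N : ℕ
  N = length core

  -- Root, core and leaves are pairwise distinct vertices. This count turns N + 4 into the desired
  -- bound.
  size : suc N ℕ.+ q ℕ.* (2 ℕ.+ p) ℕ.≤ n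
  size = Fin.injective⇒≤ {f = vertex ∘ splitAt (suc N)} λ {i} {j} eq →
    trans (sym (Fin.join-splitAt (suc N) _ i))
      (trans (cong (join (suc N) _) (vertex-injective {splitAt (suc N) i} {splitAt (suc N) j} eq))
        (Fin.join-splitAt (suc N) _ j))
    where
    vertex : Fin (suc N) ⊎ Fin (q ℕ.* (2 ℕ.+ p)) → Fin n
    vertex (inj₁ i) = lookup (u ∷ core) i
    vertex (inj₂ k) = uncurry leaf (remQuot {q} (2 ℕ.+ p) k)

    disjoint : ∀ i k → vertex (inj₁ i) ≢ vertex (inj₂ k)
    disjoint i k eq = uncurry leaf-∉ (remQuot {q} (2 ℕ.+ p) k)
      (subst (_∈ u ∷ core) eq (∈-lookup i))

    vertex-injective : Injective _≡_ _≡_ vertex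
    vertex-injective {inj₁ _} {inj₁ _} eq = cong inj₁ (lookup-injective (unique tree) eq)
    vertex-injective {inj₁ i} {inj₂ k} eq = contradiction eq (disjoint i k)
    vertex-injective {inj₂ k} {inj₁ i} eq = contradiction (sym eq) (disjoint i k)
    vertex-injective {inj₂ k} {inj₂ l} eq = cong inj₂
      (trans (sym (Fin.combine-remQuot {q} (2 ℕ.+ p) k))
        (trans (cong (uncurry combine) (leaf-injective₂ eq)) (Fin.combine-remQuot {q} (2 ℕ.+ p) l)))

  -- Since δ ≥ 3, each component has at least two leaves. The leaf zero is the partner of all
  -- others, so exchanging two colours at this leaf alone serves every pair.
  partner : Fin (2 ℕ.+ p) → Fin (2 ℕ.+ p)
  partner zero    = suc zero
  partner (suc _) = zero

  partner-≢ : ∀ j → partner j ≢ j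
  partner-≢ zero    ()
  partner-≢ (suc _) ()

  -- An edge from a leaf can leave its component only towards `u`, which belongs to the core side.
  neighbour-of-leaf : ∀ {i j x} → Adj G (leaf i j) x → x ∈ u ∷ core ⊎ ∃[ k ] leaf i k ≡ x
  neighbour-of-leaf {i} {j} {x} lx with covered x
  ... | inj₁ x∈ = inj₁ x∈
  ... | inj₂ (i′ , k , refl)
    with refl ← functional (leaf-∈ᶜ i′ k)
                  (closed (leaf-∈ᶜ i j) lx (avoids (leaf-∈ᶜ i′ k)))
    = inj₂ (k , refl)

  -- The edge to `a` will carry the primary colour and the edge to `b` the colour `mid`; `extra`
  -- provides access by the third colour.
  record Anchors (i : Fin q) (j : Fin (2 ℕ.+ p)) : Set where
    field
      a b   : Fin n
      a∈    : a ∈ u ∷ core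
      b∈    : b ∈ u ∷ core
      adj-a : Adj G (leaf i j) a
      adj-b : Adj G (leaf i j) b
      b≢a   : b ≢ a
      extra : Adj G (leaf i j) (leaf i (partner j)) ⊎
              ∃[ x ] x ∈ u ∷ core × Adj G (leaf i j) x × x ≢ a × x ≢ b

  -- A leaf has a neighbour outside any family of `2 ℕ.+ p` vertices. Excluding the leaves of its
  -- component yields `a`. The leaf is not its own neighbour, so its slot in the family can hold `a`
  -- instead, which yields `b`.
  anchors : ∀ i j → Anchors i j
  anchors i j = result
    where
    stays-in-core : ∀ {x} → Adj G (leaf i j) x → (∀ k → k ≢ j → leaf i k ≢ x) → x ∈ u ∷ core
    stays-in-core lx avoid with neighbour-of-leaf lx
    ... | inj₁ x∈ = x∈
    ... | inj₂ (k , refl) with k ≟ j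
    ...   | yes refl = contradiction lx (irrefl G)
    ...   | no  k≢j  = contradiction refl (avoid k k≢j)

    result : Anchors i j
    result
      with a , adj-a , a∉ ← neighbour-outside (leaf i j) (leaf i)
      with b , adj-b , b∉ ← neighbour-outside (leaf i j) (F.updateAt (leaf i) j (λ _ → a))
      = record
      { a = a ; b = b ; adj-a = adj-a ; adj-b = adj-b
      ; a∈ = stays-in-core adj-a λ k _ → a∉ k
      ; b∈ = stays-in-core adj-b λ k k≢j → b∉ k ∘ trans (updateAt-minimal k j (leaf i) k≢j)
      ; b≢a = λ eq → b∉ j (trans (updateAt-updates j (leaf i)) (sym eq))
      ; extra = extra
      }
      where
      j₀ = partner j
      f = F.updateAt (leaf i) j (λ _ → a)

      extra : Adj G (leaf i j) (leaf i j₀) ⊎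
              ∃[ x ] x ∈ u ∷ core × Adj G (leaf i j) x × x ≢ a × x ≢ b
      extra with adj? G (leaf i j) (leaf i j₀)
      ... | yes adj = inj₁ adj
      ... | no ¬adj
        -- The partner is not adjacent, so its slot is free as well and now excludes `b`.
        with x , adj-x , x∉ ← neighbour-outside (leaf i j) (F.updateAt f j₀ (λ _ → b))
        = inj₂ (x , stays-in-core adj-x avoid , adj-x
               , (λ eq → x∉ j (trans (updateAt-minimal j j₀ f (≢-sym (partner-≢ j)))
                                (trans (updateAt-updates j (leaf i)) (sym eq))))
               , (λ eq → x∉ j₀ (trans (updateAt-updates j₀ f) (sym eq))))
        where
        avoid : ∀ k → k ≢ j → leaf i k ≢ x
        avoid k k≢j with k ≟ j₀
        ... | yes refl = λ { refl → ¬adj adj-x }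
        ... | no k≢j₀  = x∉ k ∘ trans (trans (updateAt-minimal k j₀ f k≢j₀) (updateAt-minimal k j (leaf i) k≢j))

  -- A pair is coloured by its newer end, so a tree edge gets the number of grafts before its own.
  -- The 0 for the empty list is a junk default, reached by no edge of the tree.
  label : List (Fin n) → Fin n → Fin n → ℕ
  label []       x y = 0
  label (v ∷ vs) x y = if does (x ≟ v) ∨ does (y ≟ v) then length vs else label vs x y

  label-sym : ∀ vs x y → label vs x y ≡ label vs y x
  label-sym []       x y = refl
  label-sym (v ∷ vs) x y
    rewrite ∨-comm (does (x ≟ v)) (does (y ≟ v)) | label-sym vs x y = refl

  label-≤ : ∀ vs x y → label vs x y ℕ.≤ length vs
  label-≤ []       x y = ℕ.z≤n
  label-≤ (v ∷ vs) x y with does (x ≟ v) ∨ does (y ≟ v)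
  ... | true  = ℕ.n≤1+n _
  ... | false = ℕ.m≤n⇒m≤1+n (label-≤ vs x y)

  label-new : ∀ v w vs → label (v ∷ vs) v w ≡ length vs
  label-new v w vs rewrite dec-true (v ≟ v) refl = refl

  label-old : ∀ {v vs x y} → x ≢ v → y ≢ v → label (v ∷ vs) x y ≡ label vs x y
  label-old {v} {vs} {x} {y} x≢v y≢v rewrite dec-false (x ≟ v) x≢v | dec-false (y ≟ v) y≢v = refl

  -- Older edges avoid the new vertex, so they keep their labels, all below `length vs`; the new
  -- edge gets exactly `length vs`.
  label-rainbow : ∀ (c : Fin n → Fin n → ℕ) {vs} (t : Tree vs) →
    (∀ {x y} → x ∈ u ∷ vs → y ∈ u ∷ vs → c x y ≡ label vs x y) →
    All (ℕ._< length vs) (colours c t) × Unique (colours c t)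
  label-rainbow c [] _ = [] , []
  label-rainbow c (graft {vs} {v} {w} t v∉ w∈ vw) agree
    with below , uniq ← label-rainbow c t (λ x∈ y∈ →
      trans (agree (∈-weaken x∈) (∈-weaken y∈)) (label-old {vs = vs} (∈∧∉⇒≢ x∈ v∉) (∈∧∉⇒≢ y∈ v∉)))
    = subst (ℕ._< suc (length vs)) (sym new) (ℕ.n<1+n _) ∷ All.map ℕ.m<n⇒m<1+n below
    , All.map (λ k< eq → ℕ.<-irrefl (trans (sym eq) new) k<) below ∷ uniq
    where
    new : c v w ≡ length vs
    new = trans (agree (there (here refl)) (∈-weaken w∈)) (label-new v w vs)

  -- The N edges of the core tree use the colours below N.
  link low mid high : ℕ
  link = N
  low  = 1 ℕ.+ N
  mid  = 2 ℕ.+ N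
  high = 3 ℕ.+ N

  -- The roles of low and high are exchanged at the leaf zero, so that the colour
  -- which a leaf may lack is available at its partner.
  primary third : Fin (2 ℕ.+ p) → ℕ
  primary zero    = high
  primary (suc _) = low
  third zero    = low
  third (suc _) = high

  primary-partner : ∀ j → primary (partner j) ≡ third j
  primary-partner zero    = refl
  primary-partner (suc _) = refl

  -- The last case covers every core vertex but the two anchors, so whichever third core neighbour a
  -- leaf has gives the third colour.
  foot : Fin q → Fin (2 ℕ.+ p) → Fin n → ℕ
  foot i j x = if does (x ≟ a) then primary j else if does (x ≟ b) then mid else third j
    where open Anchors (anchors i j)

  paint : ∀ {x y} → Covered x → Covered y → ℕ
  paint {x} {y} (inj₁ _)           (inj₁ _)           = label core x y
  paint {x}     (inj₁ _)           (inj₂ (i , j , _)) = foot i j x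
  paint {y = y} (inj₂ (i , j , _)) (inj₁ _)           = foot i j y
  paint         (inj₂ _)           (inj₂ _)           = link

  c : Fin n → Fin n → ℕ
  c x y = paint (covered x) (covered y)

  c-sym : ∀ x y → c x y ≡ c y x
  c-sym x y with covered x | covered y
  ... | inj₁ _ | inj₁ _ = label-sym core x y
  ... | inj₁ _ | inj₂ _ = refl
  ... | inj₂ _ | inj₁ _ = refl
  ... | inj₂ _ | inj₂ _ = refl

  low-< : low ℕ.< 4 ℕ.+ N
  low-< = ℕ.m<n⇒m<1+n (ℕ.m<n⇒m<1+n (ℕ.n<1+n low))

  high-< : high ℕ.< 4 ℕ.+ N
  high-< = ℕ.n<1+n high

  primary-< : ∀ j → primary j ℕ.< 4 ℕ.+ N
  primary-< zero    = high-<
  primary-< (suc _) = low-<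

  third-< : ∀ j → third j ℕ.< 4 ℕ.+ N
  third-< zero    = low-<
  third-< (suc _) = high-<

  foot-< : ∀ i j x → foot i j x ℕ.< 4 ℕ.+ N
  foot-< i j x with does (x ≟ Anchors.a (anchors i j)) | does (x ≟ Anchors.b (anchors i j))
  ... | true  | _     = primary-< j
  ... | false | true  = ℕ.m<n⇒m<1+n (ℕ.n<1+n mid)
  ... | false | false = third-< j

  c-< : ∀ x y → c x y ℕ.< 4 ℕ.+ N
  c-< x y with covered x | covered y
  ... | inj₁ _           | inj₁ _           = ℕ.≤-<-trans (label-≤ core x y) (ℕ.m<n+m N ℕ.z<s)
  ... | inj₁ _           | inj₂ (i , j , _) = foot-< i j x
  ... | inj₂ (i , j , _) | inj₁ _           = foot-< i j y
  ... | inj₂ _           | inj₂ _           = ℕ.m<n+m N ℕ.z<s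

  c-core : ∀ {x y} → x ∈ u ∷ core → y ∈ u ∷ core → c x y ≡ label core x y
  c-core {x} {y} x∈ y∈ with covered x | covered y
  ... | inj₁ _              | inj₁ _              = refl
  ... | inj₂ (i , j , refl) | _                   = contradiction x∈ (leaf-∉ i j)
  ... | inj₁ _              | inj₂ (i , j , refl) = contradiction y∈ (leaf-∉ i j)

  c-foot : ∀ i j {x} → x ∈ u ∷ core → c (leaf i j) x ≡ foot i j x
  c-foot i j {x} x∈ with covered (leaf i j) | covered x
  ... | inj₁ l∈            | _                     = contradiction l∈ (leaf-∉ i j)
  ... | inj₂ _             | inj₂ (i′ , j′ , refl) = contradiction x∈ (leaf-∉ i′ j′)
  -- The indices found by `covered` need not be `i` and `j` by definition; injectivity of the leaves
  -- identifies them.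
  ... | inj₂ (i′ , j′ , eq) | inj₁ _ with refl ← leaf-injective₂ eq = refl

  c-link : ∀ i j i′ j′ → c (leaf i j) (leaf i′ j′) ≡ link
  c-link i j i′ j′ with covered (leaf i j) | covered (leaf i′ j′)
  ... | inj₁ l∈ | _       = contradiction l∈ (leaf-∉ i j)
  ... | inj₂ _  | inj₁ l∈ = contradiction l∈ (leaf-∉ i′ j′)
  ... | inj₂ _  | inj₂ _  = refl

  -- Attaching three vertices to the core tree.

  covered-elim : (P : Fin n → Set) → (∀ {v} → v ∈ u ∷ core → P v) →
    (∀ i j → P (leaf i j)) → ∀ v → P v
  covered-elim P at-core at-leaf v with covered v
  ... | inj₁ v∈             = at-core v∈
  ... | inj₂ (i , j , refl) = at-leaf i j

  -- These measure the cost of attaching `v` to the core: at most the colour `k`, respectively at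
  -- most `k` and `link`.
  Reached Linked : Fin n → ℕ → Set
  Reached v k = v ∈ u ∷ core ⊎ ∃[ x ] x ∈ u ∷ core × Adj G v x × c v x ≡ k
  Linked  v k = ∃[ w ] Reached w k × Adj G v w × c v w ≡ link

  primary-reached : ∀ i j → Reached (leaf i j) (primary j)
  primary-reached i j = inj₂ (a , a∈ , adj-a , trans (c-foot i j a∈) eq)
    where
    open Anchors (anchors i j)
    eq : foot i j a ≡ primary j
    eq rewrite dec-true (a ≟ a) refl = refl

  mid-reached : ∀ v → Reached v mid
  mid-reached = covered-elim (λ v → Reached v mid) inj₁ at-leaf
    where
    at-leaf : ∀ i j → Reached (leaf i j) mid
    at-leaf i j = inj₂ (b , b∈ , adj-b , trans (c-foot i j b∈) eq)
      where
      open Anchors (anchors i j)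
      eq : foot i j b ≡ mid
      eq rewrite dec-false (b ≟ a) b≢a | dec-true (b ≟ b) refl = refl

  -- A leaf adjacent to its partner goes through it, because the primary colour of the partner is
  -- the third colour of the leaf. Otherwise a third core neighbour exists.
  third-reached : ∀ i j → Reached (leaf i j) (third j) ⊎ Linked (leaf i j) (third j)
  third-reached i j with Anchors.extra (anchors i j)
  ... | inj₁ adj = inj₂ (leaf i (partner j)
      , subst (Reached _) (primary-partner j) (primary-reached i (partner j))
      , adj , c-link i j i (partner j))
  ... | inj₂ (x , x∈ , adj-x , x≢a , x≢b) = inj₁ (inj₂ (x , x∈ , adj-x , trans (c-foot i j x∈) eq))
    where
    open Anchors (anchors i j)
    eq : foot i j x ≡ third j
    eq rewrite dec-false (x ≟ a) x≢a | dec-false (x ≟ b) x≢b = refl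

  low-reached : ∀ v → Reached v low ⊎ Linked v low
  low-reached = covered-elim (λ v → Reached v low ⊎ Linked v low) (inj₁ ∘ inj₁) λ where
    i zero    → third-reached i zero
    i (suc j) → inj₁ (primary-reached i (suc j))

  high-reached : ∀ v → Reached v high ⊎ Linked v high
  high-reached = covered-elim (λ v → Reached v high ⊎ Linked v high) (inj₁ ∘ inj₁) λ where
    i zero    → inj₁ (primary-reached i zero)
    i (suc j) → third-reached i (suc j)

  low-or-high-reached : ∀ v → Reached v low ⊎ Reached v high
  low-or-high-reached = covered-elim (λ v → Reached v low ⊎ Reached v high) (inj₁ ∘ inj₁) λ where
    i zero    → inj₂ (primary-reached i zero)
    i (suc j) → inj₁ (primary-reached i (suc j))

  -- Here `used` bounds the extra colours from above: a vertex already present costs nothing, yet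
  -- its colour is recorded.
  record RainbowTree (goal : List (Fin n)) (used : List ℕ) : Set where
    field
      {vs}   : List (Fin n)
      T      : Tree vs
      core⊆  : ∀ {x} → x ∈ u ∷ core → x ∈ u ∷ vs
      goal⊆  : ∀ {x} → x ∈ goal → x ∈ u ∷ vs
      uniq   : Unique (colours c T)
      ⊆used  : ∀ {k} → k ∈ colours c T → k ℕ.< N ⊎ k ∈ used

  coreTree : RainbowTree [] []
  coreTree with below , uniq ← label-rainbow c tree c-core = record
    { T = tree ; core⊆ = λ x∈ → x∈ ; goal⊆ = λ () ; uniq = uniq
    ; ⊆used = λ k∈ → inj₁ (All.lookup below k∈) }

  extend : ∀ {goal used v x k} → RainbowTree goal used → x ∈ u ∷ core ⊎ x ∈ goal →
    Adj G v x → c v x ≡ k → N ℕ.≤ k → k ∉ used → RainbowTree (v ∷ goal) (k ∷ used)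
  extend {v = v} {x} R x∈ vx refl N≤k k∉ = go (v ∈? (u ∷ vs))
    where
    open RainbowTree R
    go : Dec (v ∈ u ∷ vs) → _
    go (yes v∈) = record
      { T = T ; core⊆ = core⊆ ; uniq = uniq
      ; goal⊆ = λ { (here refl) → v∈ ; (there y∈) → goal⊆ y∈ }
      ; ⊆used = λ k∈ → map₂ there (⊆used k∈) }
    go (no v∉) = record
      { T = graft T v∉ ([ core⊆ , goal⊆ ]′ x∈) vx
      ; core⊆ = ∈-weaken ∘ core⊆
      ; goal⊆ = λ { (here refl) → there (here refl) ; (there y∈) → ∈-weaken (goal⊆ y∈) }
      -- Every old colour is below N, hence below `k`, or belongs to `used`, which omits `k`.
      ; uniq = ¬Any⇒All¬ _ (λ k∈ → [ ℕ.≤⇒≯ N≤k , k∉ ]′ (⊆used k∈)) ∷ uniq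
      ; ⊆used = λ { (here eq) → inj₂ (here eq) ; (there k∈) → map₂ there (⊆used k∈) } }

  reach : ∀ {goal used v k} → RainbowTree goal used → Reached v k → N ℕ.≤ k → k ∉ used →
    RainbowTree (v ∷ goal) (k ∷ used)
  reach R (inj₁ v∈) _ _ = record
    { T = T ; core⊆ = core⊆ ; uniq = uniq
    ; goal⊆ = λ { (here refl) → core⊆ v∈ ; (there y∈) → goal⊆ y∈ }
    ; ⊆used = λ k∈ → map₂ there (⊆used k∈) }
    where open RainbowTree R
  reach R (inj₂ (x , x∈ , vx , eq)) N≤k k∉ = extend R (inj₁ x∈) vx eq N≤k k∉

  Spans : List (Fin n) → Set
  Spans xs = ∃₂ λ goal used → RainbowTree goal used × (∀ {x} → x ∈ xs → x ∈ goal)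

  spans-three : ∀ {x y z k l m} → Reached x k → Reached y l → Reached z m ⊎ Linked z m →
    Unique (link ∷ m ∷ l ∷ k ∷ []) → N ℕ.≤ k → N ℕ.≤ l → N ℕ.≤ m → Spans (z ∷ y ∷ x ∷ [])
  spans-three rx ry rz (link∉ ∷ m∉ ∷ l∉ ∷ _) N≤k N≤l N≤m with rz
  ... | inj₁ rz′ = _ , _ , reach R₂ rz′ N≤m (All¬⇒¬Any m∉) , λ x∈ → x∈
    where
    R₂ = reach (reach coreTree rx N≤k λ ()) ry N≤l (All¬⇒¬Any l∉)
  ... | inj₂ (w , rw , zw , eq) =
    _ , _ , extend R₃ (inj₂ (here refl)) zw eq ℕ.≤-refl (All¬⇒¬Any link∉)
    -- The goal list also contains the intermediate leaf `w` right after `z`; it is skipped.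
    , λ { (here eq) → here eq ; (there x∈) → there (there x∈) }
    where
    R₂ = reach (reach coreTree rx N≤k λ ()) ry N≤l (All¬⇒¬Any l∉)
    R₃ = reach R₂ rw N≤m (All¬⇒¬Any m∉)

  spans : ∀ x y z → Spans (z ∷ y ∷ x ∷ [])
  spans x y z with low-or-high-reached x
  ... | inj₁ x-low  = spans-three x-low (mid-reached y) (high-reached z)
    -- The colours are the numerals 0, 3, 2, 1 shifted by N, so it suffices that the numerals
    -- differ.
    (Unique.map⁺ (ℕ.+-cancelʳ-≡ N _ _)
      (((λ ()) ∷ (λ ()) ∷ (λ ()) ∷ []) ∷ ((λ ()) ∷ (λ ()) ∷ []) ∷ ((λ ()) ∷ []) ∷ [] ∷ []))
    (ℕ.m≤n+m N 1) (ℕ.m≤n+m N 2) (ℕ.m≤n+m N 3)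
  ... | inj₂ x-high = spans-three x-high (mid-reached y) (low-reached z)
    (Unique.map⁺ (ℕ.+-cancelʳ-≡ N _ _)
      (((λ ()) ∷ (λ ()) ∷ (λ ()) ∷ []) ∷ ((λ ()) ∷ (λ ()) ∷ []) ∷ ((λ ()) ∷ []) ∷ [] ∷ []))
    (ℕ.m≤n+m N 3) (ℕ.m≤n+m N 2) (ℕ.m≤n+m N 1)

  colouring : EdgeColouring G (4 ℕ.+ N)
  colouring = record
    { colour      = λ x y → fromℕ< (c-< x y)
    ; colour-symm = λ x y → Fin.fromℕ<-cong _ _ (c-sym x y) (c-< x y) (c-< y x)
    }

  colouring-rainbow : Is3RainbowColouring {G = G} colouring
  colouring-rainbow S ∣S∣≡3
    with x , y , z , S⊆ ← enum-triple S ∣S∣≡3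
    with goal , used , R , ⊆goal ← spans x y z
    = subgraph T , subgraph-isTree T , is-rainbow , 
      λ s∈ → members⁺ T (goal⊆ (⊆goal (S⊆ s∈)))
    where
    open RainbowTree R

    is-rainbow : IsRainbow {G = G} colouring (subgraph T)
    is-rainbow e e′ eq = map (λ (p , q) → Members-≡ p , Members-≡ q) (λ (p , q) → Members-≡ p , Members-≡ q)
      (rainbow c c-sym T uniq e e′ (Fin.fromℕ<-injective _ _ (c-< _ _) (c-< _ _) eq))

  -- The additive form avoids truncated subtraction.
  rx₃-bound : ∀ {r} → IsRx₃ G r → r ℕ.+ q ℕ.* (2 ℕ.+ p) ℕ.≤ n ℕ.+ 3
  rx₃-bound {r} (_ , r≤) = begin
    r ℕ.+ q ℕ.* (2 ℕ.+ p)                ≤⟨ ℕ.+-monoˡ-≤ _ (r≤ _ (colouring , colouring-rainbow)) ⟩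
    3 ℕ.+ (suc N ℕ.+ q ℕ.* (2 ℕ.+ p))    ≤⟨ ℕ.+-monoʳ-≤ 3 size ⟩
    3 ℕ.+ n                              ≡⟨ ℕ.+-comm 3 n ⟩
    n ℕ.+ 3                              ∎
    where open ℕ.≤-Reasoning

-- The bound over the integers.

theorem4p3 : ∀ (n : ℕ) (G : Graph (Fin n)) (δ q r : ℕ) →
    Connected G → IsMinDegree G δ → 3 ℕ.≤ δ → IsQMax G q → IsRx₃ G r →
    + r ≤ + n - + q * (+ δ - + 1) + + 3
-- With δ = 3 + p, each component keeps δ - 1 = 2 + p leaves.
theorem4p3 n G (suc (suc (suc p))) q r (_ , connected) (_ , δ≤) (ℕ.s≤s (ℕ.s≤s (ℕ.s≤s _)))
  ((u , comps) , _) rx₃ = begin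
    + r                               ≡⟨ ℤ.+-identityʳ (+ r) ⟨
    + r + + 0                         ≡⟨ cong (λ k → + r + k) (ℤ.+-inverseʳ (+ m)) ⟨
    + r + (+ m - + m)                 ≡⟨ ℤ.+-assoc (+ r) (+ m) (- + m) ⟨
    + (r ℕ.+ m) - + m                 ≤⟨ ℤ.+-monoˡ-≤ (- + m) (+≤+ r+m≤n+3) ⟩
    + n + + 3 - + m                   ≡⟨ ℤ.+-assoc (+ n) (+ 3) (- + m) ⟩
    + n + (+ 3 - + m)                 ≡⟨ cong (λ k → + n + k) (ℤ.+-comm (+ 3) (- + m)) ⟩
    + n + (- + m + + 3)               ≡⟨ ℤ.+-assoc (+ n) (- + m) (+ 3) ⟨
    -- The factor `+ (3 ℕ.+ p) - + 1` computes to `+ (2 ℕ.+ p)`.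
    + n - + m + + 3                   ≡⟨ cong (λ k → + n - k + + 3) (ℤ.pos-* q (2 ℕ.+ p)) ⟩
    + n - + q * (+ (3 ℕ.+ p) - + 1) + + 3 ∎
  where
  open ℤ.≤-Reasoning

  m : ℕ
  m = q ℕ.* (2 ℕ.+ p)

  to-root : ∀ x → Reachable G x u
  to-root x = connected x u

  deg : ∀ v → 3 ℕ.+ p ℕ.≤ degree G v
  deg v = δ≤ _ (v , refl)

  splitting : Splitting G u q
  splitting = componentSplitting G u comps

  r+m≤n+3 : r ℕ.+ m ℕ.≤ n ℕ.+ 3
  r+m≤n+3 = Colouring.rx₃-bound G u splitting to-root deg
    (Leafing.saturated G u splitting to-root deg) rx₃
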